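{- There exist $0$-map graphs which are not contact string graphs.
   Context: All graphs are finite and simple. $0$-map graph: start with a plane graph $G_0$ (a graph embedded in the sphere, equivalently the plane), with each face (including the outer face) labeled a nation or a lake; $G$ is the graph whose vertices are the nations, two distinct vertices being adjacent iff the corresponding faces share a vertex of $G_0$. Equivalently, there is a planar bipartite graph $H$ with bipartition $(X,Y)$ such that $V(G)=X$ and two distinct vertices of $X$ are adjacent in $G$ iff they have a common neighbor in $Y$. A simple curve (string) in $\mathbb{R}^2$ is a subset of $\mathbb{R}^2$ homeomorphic to $[0,1]$; its interior is the curve minus its two endpoints. A contact string graph is the intersection graph of a finite set of simple curves in $\mathbb{R}^2$ whose interiors are pairwise disjoint (vertices are the curves, two distinct ones adjacent iff they intersect). -}

module Defs where

open import Data.Bool using (Bool; false; T)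
open import Data.Fin using (Fin)
open import Data.Nat as ℕ using (ℕ)
open import Data.Product using (Σ; ∃-syntax; _×_; _,_)
open import Data.Rational using (ℚ; 0ℚ; 1ℚ; _+_; _-_; ∣_∣; _≤_; _<_)
open import Data.Rational.Properties
  using (≤-refl; ≤-trans; ≤-reflexive; <⇒≤; <-respˡ-≡; nonNegative⁻¹;
         +-inverseʳ; +-identityʳ; +-monoʳ-≤)
open import Data.Sum using (_⊎_; inj₁; inj₂)
open import Function.Bundles using (_⇔_)
open import Relation.Binary.PropositionalEquality using (_≡_; _≢_; sym; cong)
open import Relation.Nullary using (¬_)

-- Real numbers are Cauchy sequences of rationals, with equality _≈_.

record ℝ : Set where
  constructor mkℝ
  field
    seq    : ℕ → ℚ
    cauchy : ∀ ε → 0ℚ < ε →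
             ∃[ N ] (∀ m n → N ℕ.≤ m → N ℕ.≤ n → ∣ seq m - seq n ∣ < ε)
open ℝ public

infix 4 _≤ʳ_ _≈_

_≤ʳ_ : ℝ → ℝ → Set
x ≤ʳ y = ∀ ε → 0ℚ < ε → ∃[ N ] (∀ n → N ℕ.≤ n → seq x n ≤ seq y n + ε)

-- Within ε x y says that the real number |x - y| is strictly below ε: the
-- eventual bound δ is uniformly below ε, so the limit cannot be equal to ε.
Within : ℚ → ℝ → ℝ → Set
Within ε x y =
  ∃[ δ ] (δ < ε × ∃[ N ] (∀ n → N ℕ.≤ n → ∣ seq x n - seq y n ∣ ≤ δ))

_≈_ : ℝ → ℝ → Set
x ≈ y = ∀ ε → 0ℚ < ε → Within ε x y

fromℚ : ℚ → ℝ
fromℚ q = mkℝ (λ _ → q)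
  (λ ε 0<ε → 0 , λ _ _ _ _ → <-respˡ-≡ (sym (cong ∣_∣ (+-inverseʳ q))) 0<ε)

fromℚ-mono : ∀ {p q} → p ≤ q → fromℚ p ≤ʳ fromℚ q
fromℚ-mono {p} {q} p≤q ε 0<ε = 0 , λ _ _ →
  ≤-trans p≤q (≤-trans (≤-reflexive (sym (+-identityʳ q))) (+-monoʳ-≤ q (<⇒≤ 0<ε)))

0≤1 : 0ℚ ≤ 1ℚ
0≤1 = nonNegative⁻¹ 1ℚ

record Interval : Set where
  constructor mkI
  field
    value : ℝ
    lower : fromℚ 0ℚ ≤ʳ value
    upper : value ≤ʳ fromℚ 1ℚ
open Interval public

0ᴵ 1ᴵ : Interval
0ᴵ = mkI (fromℚ 0ℚ) (fromℚ-mono ≤-refl) (fromℚ-mono 0≤1)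
1ᴵ = mkI (fromℚ 1ℚ) (fromℚ-mono 0≤1) (fromℚ-mono ≤-refl)

Point : Set
Point = ℝ × ℝ

infix 4 _≈ₚ_

_≈ₚ_ : Point → Point → Set
(x , y) ≈ₚ (x′ , y′) = x ≈ x′ × y ≈ y′

-- The open ball of radius ε in the maximum metric, which induces the usual
-- topology of the plane.
Withinₚ : ℚ → Point → Point → Set
Withinₚ ε (x , y) (x′ , y′) = Within ε x x′ × Within ε y y′

-- A homeomorphism from [0,1] onto a subset of the plane.  The field
-- inverse-continuous is continuity of the inverse map on the image; it also
-- yields injectivity up to ≈ (use it with arbitrarily small ε), just as
-- continuous yields that the map respects ≈.
record SimpleCurve : Set where
  field
    path               : Interval → Point
    continuous         : ∀ t ε → 0ℚ < ε →
      ∃[ δ ] (0ℚ < δ × (∀ s → Within δ (value s) (value t) →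
                              Withinₚ ε (path s) (path t)))
    inverse-continuous : ∀ t ε → 0ℚ < ε →
      ∃[ δ ] (0ℚ < δ × (∀ s → Withinₚ δ (path s) (path t) →
                              Within ε (value s) (value t)))

  start end : Point
  start = path 0ᴵ
  end   = path 1ᴵ
open SimpleCurve public

infix 4 _On_ _InInterior_

_On_ : Point → SimpleCurve → Set
p On γ = ∃[ t ] path γ t ≈ₚ p

_InInterior_ : Point → SimpleCurve → Set
p InInterior γ = p On γ × ¬ (p ≈ₚ start γ) × ¬ (p ≈ₚ end γ)

Intersect : SimpleCurve → SimpleCurve → Set
Intersect γ γ′ = ∃[ p ] (p On γ × p On γ′)

DisjointInteriors : SimpleCurve → SimpleCurve → Set
DisjointInteriors γ γ′ = ¬ (∃[ p ] (p InInterior γ × p InInterior γ′))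

-- A simple graph on V; finiteness comes from the vertex types used below
-- (Fin n and Fin n ⊎ Fin m).
record Graph (V : Set) : Set where
  field
    adj       : V → V → Bool
    symmetric : ∀ u v → adj u v ≡ adj v u
    loopless  : ∀ v → adj v v ≡ false

  Adj : V → V → Set
  Adj u v = T (adj u v)
open Graph public

SameEdge : {V : Set} → V → V → V → V → Set
SameEdge u v u′ v′ = (u ≡ u′ × v ≡ v′) ⊎ (u ≡ v′ × v ≡ u′)

-- Both (u , v) and (v , u) index the edge uv; arc-reverse makes them name the
-- same subset of the plane.
record PlaneDrawing {V : Set} (G : Graph V) : Set where
  field
    position          : V → Point
    position-distinct : ∀ u v → u ≢ v → ¬ (position u ≈ₚ position v)
    arc               : ∀ u v → Adj G u v → SimpleCurve
    arc-reverse       : ∀ u v (e : Adj G u v) (e′ : Adj G v u) p →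
                        p On arc u v e → p On arc v u e′
    arc-ends          : ∀ u v (e : Adj G u v) →
      (start (arc u v e) ≈ₚ position u × end (arc u v e) ≈ₚ position v) ⊎
      (start (arc u v e) ≈ₚ position v × end (arc u v e) ≈ₚ position u)
    arc-avoids        : ∀ u v (e : Adj G u v) w →
                        ¬ (position w InInterior arc u v e)
    arcs-disjoint     : ∀ u v (e : Adj G u v) u′ v′ (e′ : Adj G u′ v′) →
                        ¬ SameEdge u v u′ v′ →
                        DisjointInteriors (arc u v e) (arc u′ v′ e′)

Planar : {V : Set} → Graph V → Set
Planar G = PlaneDrawing G

Bipartite : {X Y : Set} → Graph (X ⊎ Y) → Set
Bipartite H = (∀ x x′ → ¬ Adj H (inj₁ x) (inj₁ x′)) ×
              (∀ y y′ → ¬ Adj H (inj₂ y) (inj₂ y′))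

ZeroMapGraph : ∀ {n} → Graph (Fin n) → Set
ZeroMapGraph {n} G =
  ∃[ m ] Σ (Graph (Fin n ⊎ Fin m)) λ H →
    Bipartite H × Planar H ×
    (∀ x x′ → x ≢ x′ →
      Adj G x x′ ⇔ (∃[ y ] (Adj H (inj₁ x) (inj₂ y) × Adj H (inj₁ x′) (inj₂ y))))

-- Disjointness of the interiors forces the curves of distinct vertices to be
-- distinct subsets of the plane, so the vertices are indeed a set of curves.
ContactStringGraph : ∀ {n} → Graph (Fin n) → Set
ContactStringGraph {n} G =
  Σ (Fin n → SimpleCurve) λ γ →
    (∀ i j → i ≢ j → DisjointInteriors (γ i) (γ j)) ×
    (∀ i j → i ≢ j → Adj G i j ⇔ Intersect (γ i) (γ j))

{-# OPTIONS --safe #-}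

-- Two strings with disjoint interiors can only meet at an endpoint of one of them.  So n strings
-- have 2n endpoint slots, and every edge uv of the contact graph is covered by a slot whose point
-- lies on both u and v.  The strings through a point p form a clique C, and at most one of them
-- does not end at p, so at least |C| - 1 slots sit at p.  Consequently, if a set M of edges has at
-- most |C| - 1 members inside every clique C, then |M| ≤ 2n.  For n = 16 there is a 0-map graph
-- with such a set M of 33 edges.  Its planar bipartite witness, with 16 + 7 vertices, is drawn with
-- straight edges between integer points; there, two edges have disjoint interiors because the line
-- through one of them separates it from the other, which is a matter of signs of determinants.
module Submission where

open import Defs
open import Axiom.ExcludedMiddle using (ExcludedMiddle)
open import Data.Bool using (Bool; true; false; T; T?)
open import Data.Bool.ListAction using (all)
open import Data.Fin using (Fin; _≟_)
import Data.Fin.Properties as Fin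
open import Data.Integer as ℤ using (ℤ; 0ℤ)
import Data.Integer.Properties as ℤ
open import Data.List
  using (List; []; _∷_; _++_; map; filter; filterᵇ; length; allFin; cartesianProduct)
open import Data.List.Membership.DecPropositional using (_∈?_)
open import Data.List.Membership.Propositional using (_∈_)
open import Data.List.Membership.Propositional.Properties
  using (∈-++⁺ˡ; ∈-++⁺ʳ; ∈-map⁺; ∈-filter⁺; ∈-allFin)
open import Data.List.Properties using (length-map; length-tabulate; filter-accept)
open import Data.List.Relation.Binary.Sublist.Propositional using (_⊆_; []; _∷_; _∷ʳ_)
open import Data.List.Relation.Binary.Sublist.Propositional.Properties using (filter-⊆)
open import Data.List.Relation.Unary.All as All using (All; []; _∷_)
import Data.List.Relation.Unary.All.Properties as All
open import Data.List.Relation.Unary.AllPairs using (AllPairs; []; _∷_)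
open import Data.List.Relation.Unary.Any using (here)
open import Data.List.Relation.Unary.Unique.Propositional using (Unique)
import Data.List.Relation.Unary.Unique.Propositional.Properties as Unique
open import Data.Nat as ℕ using (ℕ; suc; z≤n; s≤s; s≤s⁻¹; _∸_)
import Data.Nat.Coprimality as Coprimality
open import Data.Nat.DivMod using (_mod_)
import Data.Nat.Properties as ℕ
open import Data.Product using (Σ; ∃-syntax; _×_; _,_; proj₁; proj₂; map₂)
open import Data.Rational
  using (ℚ; 0ℚ; 1ℚ; ½; mkℚ; ↥_; *≤*; *<*; _/_; _+_; _*_; _-_; -_; ∣_∣; 1/_; _≤_; _<_;
         NonZero; Positive; positive; nonNegative; ≢-nonZero)
import Data.Rational.Properties as ℚ
open import Data.Sum as Sum using (_⊎_; inj₁; inj₂; [_,_]′)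
open import Data.Sum.Properties using (≡-dec)
open import Data.Unit using (tt)
open import Data.Vec using (Vec; []; _∷_; lookup)
open import Function using (_∘_; _⇔_; mk⇔; Equivalence)
open import Level using (0ℓ)
open import Relation.Binary using (Rel; Decidable; Reflexive; Symmetric; Transitive)
open import Relation.Binary.PropositionalEquality
  using (_≡_; _≢_; refl; sym; trans; cong; cong₂; subst; subst₂)
open import Relation.Nullary using (¬_; Dec; yes; no; does; ¬?; contradiction)
open import Relation.Nullary.Decidable
  using (_×-dec_; _⊎-dec_; _→-dec_; map′; toWitness; dec⇒maybe; dec-false; does-⇔)
open import Relation.Unary using (Pred) renaming (Decidable to Decidable₁)
open import Tactic.RingSolver using (solve-∀)
open import Tactic.RingSolver.Core.AlmostCommutativeRing
  using (AlmostCommutativeRing; fromCommutativeRing)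

-- Sequences of rationals up to null sequences

ℚ-ring : AlmostCommutativeRing 0ℓ 0ℓ
ℚ-ring = fromCommutativeRing ℚ.+-*-commutativeRing λ x → dec⇒maybe (0ℚ ℚ.≟ x)

neg-involutive : ∀ x → - (- x) ≡ x
neg-involutive = solve-∀ ℚ-ring

Eventually : (ℕ → Set) → Set
Eventually P = ∃[ N ] (∀ n → N ℕ.≤ n → P n)

eventually-∧ : ∀ {P Q} → Eventually P → Eventually Q → Eventually (λ n → P n × Q n)
eventually-∧ (M , p) (N , q) = M ℕ.+ N , λ n l →
  p n (ℕ.≤-trans (ℕ.m≤m+n M N) l) , q n (ℕ.≤-trans (ℕ.m≤n+m N M) l)

eventually-map : ∀ {P Q : ℕ → Set} → (∀ n → P n → Q n) → Eventually P → Eventually Q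
eventually-map f = map₂ λ p n l → f n (p n l)

half-positive : ∀ {ε} → 0ℚ < ε → 0ℚ < ε * ½
half-positive {ε} 0<ε = subst (_< ε * ½) (ℚ.*-zeroˡ ½) (ℚ.*-monoˡ-<-pos ½ 0<ε)

half+half : ∀ ε → ε * ½ + ε * ½ ≡ ε
half+half ε = trans (sym (ℚ.*-distribˡ-+ ε ½ ½)) (ℚ.*-identityʳ ε)

half< : ∀ {ε} → 0ℚ < ε → ε * ½ < ε
half< {ε} 0<ε = subst₂ _<_ (ℚ.+-identityʳ _) (half+half ε) (ℚ.+-monoʳ-< (ε * ½) (half-positive 0<ε))

-- Dividing `ε` by `c + 1` instead of `c` treats `c = 0` uniformly: then `c * δ + δ` is exactly `ε`.
scale-below : ∀ c ε → 0ℚ ≤ c → 0ℚ < ε → ∃[ δ ] (0ℚ < δ × c * δ < ε)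
scale-below c ε 0≤c 0<ε = δ , 0<δ , cδ<ε
  where
  K = c + 1ℚ
  0<K : 0ℚ < K
  0<K = ℚ.+-mono-≤-< 0≤c (ℚ.positive⁻¹ 1ℚ)
  instance
    K-positive : Positive K
    K-positive = positive 0<K
    K-nonZero : NonZero K
    K-nonZero = ℚ.pos⇒nonZero K
    1/K-positive : Positive (1/ K)
    1/K-positive = ℚ.1/pos⇒pos K
  δ = ε * 1/ K
  0<δ : 0ℚ < δ
  0<δ = subst (_< δ) (ℚ.*-zeroˡ (1/ K)) (ℚ.*-monoˡ-<-pos (1/ K) 0<ε)
  cδ+δ≡ε : c * δ + δ ≡ ε
  cδ+δ≡ε = trans (identity c ε (1/ K)) (trans (cong (ε *_) (ℚ.*-inverseˡ K)) (ℚ.*-identityʳ ε))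
    where
    identity : ∀ c ε r → c * (ε * r) + ε * r ≡ ε * (r * (c + 1ℚ))
    identity = solve-∀ ℚ-ring
  cδ<ε : c * δ < ε
  cδ<ε = subst₂ _<_ (ℚ.+-identityʳ _) cδ+δ≡ε (ℚ.+-monoʳ-< (c * δ) 0<δ)

-- The limit inferior of `z` is at least 0. Comparisons of reals are reduced to such sign conditions
-- on rational sequences, so that algebraic identities can be applied term by term.
record Nonneg (z : ℕ → ℚ) : Set where
  constructor mkNonneg
  field
    above : ∀ ε → 0ℚ < ε → Eventually λ n → 0ℚ ≤ z n + ε
open Nonneg

record Null (z : ℕ → ℚ) : Set where
  constructor _,_
  field
    nonneg : Nonneg z
    nonpos : Nonneg (λ n → - z n)
open Null

nonneg-cong : ∀ {y z} → (∀ n → y n ≡ z n) → Nonneg y → Nonneg z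
nonneg-cong eq y≥0 = mkNonneg λ ε 0<ε →
  eventually-map (λ n → subst (λ q → 0ℚ ≤ q + ε) (eq n)) (above y≥0 ε 0<ε)

nonneg-+ : ∀ {y z} → Nonneg y → Nonneg z → Nonneg (λ n → y n + z n)
nonneg-+ {y} {z} y≥0 z≥0 = mkNonneg λ ε 0<ε → eventually-map
  (λ n (p , q) → subst (0ℚ ≤_) (trans (identity (y n) (z n) (ε * ½)) (cong (y n + z n +_) (half+half ε)))
                       (ℚ.+-mono-≤ p q))
  (eventually-∧ (above y≥0 _ (half-positive 0<ε)) (above z≥0 _ (half-positive 0<ε)))
  where
  identity : ∀ a b e → a + e + (b + e) ≡ a + b + (e + e)
  identity = solve-∀ ℚ-ring

*-nonneg : ∀ c q → 0ℚ ≤ c → 0ℚ ≤ q → 0ℚ ≤ c * q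
*-nonneg c q 0≤c 0≤q =
  subst (_≤ c * q) (ℚ.*-zeroʳ c) (ℚ.*-monoˡ-≤-nonNeg c {{nonNegative 0≤c}} {0ℚ} {q} 0≤q)

nonneg-* : ∀ {z} c → 0ℚ ≤ c → Nonneg z → Nonneg (λ n → c * z n)
nonneg-* {z} c 0≤c z≥0 = mkNonneg λ ε 0<ε →
  let δ , 0<δ , cδ<ε = scale-below c ε 0≤c 0<ε
  in eventually-map (λ n → pointwise (z n) δ ε (ℚ.<⇒≤ cδ<ε)) (above z≥0 δ 0<δ)
  where
  pointwise : ∀ x δ ε → c * δ ≤ ε → 0ℚ ≤ x + δ → 0ℚ ≤ c * x + ε
  pointwise x δ ε cδ≤ε p = ℚ.≤-trans {0ℚ} {c * x + c * δ} {c * x + ε}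
    (subst (0ℚ ≤_) (ℚ.*-distribˡ-+ c x δ) (*-nonneg c (x + δ) 0≤c p))
    (ℚ.+-monoʳ-≤ (c * x) {c * δ} {ε} cδ≤ε)

nonneg-const : ∀ {c} → Nonneg (λ _ → c) → 0ℚ ≤ c
nonneg-const {c} c≥0 with 0ℚ ℚ.≤? c
... | yes 0≤c = 0≤c
-- With the tolerance `- c * ½` the condition would read 0 ≤ c/2, although `c` is negative.
... | no  0≰c with N , p ← above c≥0 (- c * ½) (half-positive (ℚ.neg-antimono-< (ℚ.≰⇒> 0≰c)))
  = contradiction
      (ℚ.≤-<-trans
        (subst (0ℚ ≤_) (trans (cong (_+ - c * ½) (sym (half+half c))) (identity c ½)) (p N ℕ.≤-refl))
        (subst (c * ½ <_) (ℚ.*-zeroˡ ½) (ℚ.*-monoˡ-<-pos ½ (ℚ.≰⇒> 0≰c))))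
      (ℚ.<-irrefl refl)
  where
  identity : ∀ c h → c * h + c * h + - c * h ≡ c * h
  identity = solve-∀ ℚ-ring

null-cong : ∀ {y z} → (∀ n → y n ≡ z n) → Null y → Null z
null-cong eq (p , q) = nonneg-cong eq p , nonneg-cong (λ n → cong -_ (eq n)) q

null-+ : ∀ {y z} → Null y → Null z → Null (λ n → y n + z n)
null-+ {y} {z} (p , q) (p′ , q′) =
  nonneg-+ p p′ , nonneg-cong (λ n → sym (ℚ.neg-distrib-+ (y n) (z n))) (nonneg-+ q q′)

null-neg : ∀ {z} → Null z → Null (λ n → - z n)
null-neg {z} (p , q) = q , nonneg-cong (λ n → sym (neg-involutive (z n))) p

null-* : ∀ {z} c → Null z → Null (λ n → c * z n)
null-* {z} c (p , q) with ℚ.≤-total 0ℚ c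
... | inj₁ 0≤c = nonneg-* c 0≤c p , nonneg-cong (λ n → sym (ℚ.neg-distribʳ-* c (z n))) (nonneg-* c 0≤c q)
... | inj₂ c≤0 = nonneg-cong (λ n → neg*neg c (z n)) (nonneg-* (- c) 0≤-c q)
               , nonneg-cong (λ n → sym (ℚ.neg-distribˡ-* c (z n))) (nonneg-* (- c) 0≤-c p)
  where
  0≤-c = ℚ.neg-antimono-≤ c≤0
  neg*neg : ∀ a b → - a * - b ≡ a * b
  neg*neg = solve-∀ ℚ-ring

null-const : ∀ {c} → Null (λ _ → c) → c ≡ 0ℚ
null-const {c} (p , q) = ℚ.≤-antisym
  (subst (_≤ 0ℚ) (neg-involutive c) (ℚ.neg-antimono-≤ (nonneg-const q))) (nonneg-const p)

∣∣≤⇒ : ∀ {p q} → ∣ p ∣ ≤ q → 0ℚ ≤ p + q × 0ℚ ≤ - p + q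
∣∣≤⇒ {p} {q} l =
  subst (_≤ p + q) (ℚ.+-inverseʳ p) (ℚ.+-monoʳ-≤ p (ℚ.≤-trans (-p≤∣p∣ p) l)) ,
  subst (_≤ - p + q) (ℚ.+-inverseˡ p) (ℚ.+-monoʳ-≤ (- p) (ℚ.≤-trans (p≤∣p∣ p) l))
  where
  p≤∣p∣ : ∀ p → p ≤ ∣ p ∣
  p≤∣p∣ p with ℚ.≤-total 0ℚ p
  ... | inj₁ 0≤p = ℚ.≤-reflexive (sym (ℚ.0≤p⇒∣p∣≡p 0≤p))
  ... | inj₂ p≤0 = ℚ.≤-trans p≤0 (ℚ.0≤∣p∣ p)
  -p≤∣p∣ : ∀ p → - p ≤ ∣ p ∣
  -p≤∣p∣ p = subst (- p ≤_) (ℚ.∣-p∣≡∣p∣ p) (p≤∣p∣ (- p))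

⇒∣∣≤ : ∀ {p q} → 0ℚ ≤ p + q → 0ℚ ≤ - p + q → ∣ p ∣ ≤ q
⇒∣∣≤ {p} {q} a b with ℚ.∣p∣≡p∨∣p∣≡-p p
... | inj₁ eq = subst₂ _≤_ (trans (ℚ.+-identityʳ p) (sym eq)) (identity p q) (ℚ.+-monoʳ-≤ p b)
  where
  identity : ∀ p q → p + (- p + q) ≡ q
  identity = solve-∀ ℚ-ring
... | inj₂ eq = subst₂ _≤_ (trans (ℚ.+-identityʳ (- p)) (sym eq)) (identity p q) (ℚ.+-monoʳ-≤ (- p) a)
  where
  identity : ∀ p q → - p + (p + q) ≡ q
  identity = solve-∀ ℚ-ring

≈⇒null : ∀ {x y} → x ≈ y → Null (λ n → seq x n - seq y n)
≈⇒null {x} {y} x≈y = mkNonneg (λ ε 0<ε → eventually-map (λ _ → proj₁) (both ε 0<ε))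
                   , mkNonneg (λ ε 0<ε → eventually-map (λ _ → proj₂) (both ε 0<ε))
  where
  both : ∀ ε → 0ℚ < ε → Eventually λ n →
         0ℚ ≤ seq x n - seq y n + ε × 0ℚ ≤ - (seq x n - seq y n) + ε
  both ε 0<ε = let δ , δ<ε , ev = x≈y ε 0<ε
               in eventually-map (λ n l → ∣∣≤⇒ (ℚ.≤-trans l (ℚ.<⇒≤ δ<ε))) ev

null⇒≈ : ∀ {x y} → Null (λ n → seq x n - seq y n) → x ≈ y
-- `Within` asks for a bound strictly below `ε`, hence the half.
null⇒≈ (p , q) ε 0<ε = ε * ½ , half< 0<ε ,
  eventually-map (λ n (a , b) → ⇒∣∣≤ a b)
    (eventually-∧ (above p _ (half-positive 0<ε)) (above q _ (half-positive 0<ε)))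

nonneg-0 : Nonneg (λ _ → 0ℚ)
nonneg-0 = mkNonneg λ ε 0<ε → 0 , λ _ _ → ℚ.≤-trans (ℚ.<⇒≤ 0<ε) (ℚ.≤-reflexive (sym (ℚ.+-identityˡ ε)))

≡⇒≈ : ∀ {x y} → (∀ n → seq x n ≡ seq y n) → x ≈ y
≡⇒≈ {x} {y} eq = null⇒≈ {x} {y}
  (null-cong (λ n → sym (trans (cong (_- seq y n) (eq n)) (ℚ.+-inverseʳ (seq y n)))) (nonneg-0 , nonneg-0))

≈-sym : ∀ {x y} → x ≈ y → y ≈ x
≈-sym {x} {y} p = null⇒≈ {y} {x} (null-cong (λ n → swap (seq x n) (seq y n)) (null-neg (≈⇒null {x} {y} p)))
  where
  swap : ∀ a b → - (a - b) ≡ b - a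
  swap = solve-∀ ℚ-ring

≈-trans : ∀ {x y z} → x ≈ y → y ≈ z → x ≈ z
≈-trans {x} {y} {z} p q = null⇒≈ {x} {z}
  (null-cong (λ n → telescope (seq x n) (seq y n) (seq z n)) (null-+ (≈⇒null {x} {y} p) (≈⇒null {y} {z} q)))
  where
  telescope : ∀ a b c → (a - b) + (b - c) ≡ a - c
  telescope = solve-∀ ℚ-ring

≈ₚ-refl : ∀ {p} → p ≈ₚ p
≈ₚ-refl {x , y} = ≡⇒≈ {x} {x} (λ _ → refl) , ≡⇒≈ {y} {y} (λ _ → refl)

≈ₚ-sym : ∀ {p q} → p ≈ₚ q → q ≈ₚ p
≈ₚ-sym {p} {q} (a , b) = ≈-sym {proj₁ p} {proj₁ q} a , ≈-sym {proj₂ p} {proj₂ q} b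

≈ₚ-trans : ∀ {p q r} → p ≈ₚ q → q ≈ₚ r → p ≈ₚ r
≈ₚ-trans {p} {q} {r} (a , b) (c , d) =
  ≈-trans {proj₁ p} {proj₁ q} {proj₁ r} a c , ≈-trans {proj₂ p} {proj₂ q} {proj₂ r} b d

-- Segments

*-mono-≤ : ∀ c p q → 0ℚ ≤ c → p ≤ q → c * p ≤ c * q
*-mono-≤ c p q 0≤c = ℚ.*-monoˡ-≤-nonNeg c {{nonNegative 0≤c}} {p} {q}

-- The Lipschitz estimate behind both continuity and inverse continuity of segments. Since `δ` is
-- chosen before the reals, one `δ` serves both coordinates.
within-scale : ∀ K ε → 0ℚ ≤ K → 0ℚ < ε → ∃[ δ ] (0ℚ < δ × (∀ x y x′ y′ →
  (∀ n → ∣ seq x′ n - seq y′ n ∣ ≤ K * ∣ seq x n - seq y n ∣) → Within δ x y → Within ε x′ y′))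
within-scale K ε 0≤K 0<ε = δ , 0<δ , λ x y x′ y′ l (η , η<δ , ev) →
  K * η , ℚ.≤-<-trans {K * η} {K * δ} {ε} (*-mono-≤ K η δ 0≤K (ℚ.<⇒≤ η<δ)) Kδ<ε ,
  eventually-map (λ n → chain (∣ seq x′ n - seq y′ n ∣) (∣ seq x n - seq y n ∣) η (l n)) ev
  where
  scaled = scale-below K ε 0≤K 0<ε
  δ = proj₁ scaled
  0<δ = proj₁ (proj₂ scaled)
  Kδ<ε : K * δ < ε
  Kδ<ε = proj₂ (proj₂ scaled)
  chain : ∀ u v η → u ≤ K * v → v ≤ η → u ≤ K * η
  chain u v η l p = ℚ.≤-trans {u} {K * v} {K * η} l (*-mono-≤ K v η 0≤K p)

affine-difference : ∀ a c u v → ∣ (a + c * u) - (a + c * v) ∣ ≡ ∣ c ∣ * ∣ u - v ∣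
affine-difference a c u v = trans (cong ∣_∣ (identity a c u v)) (ℚ.∣p*q∣≡∣p∣*∣q∣ c (u - v))
  where
  identity : ∀ a c u v → (a + c * u) - (a + c * v) ≡ c * (u - v)
  identity = solve-∀ ℚ-ring

affine : ℚ → ℚ → ℝ → ℝ
affine a c t = mkℝ (λ n → a + c * seq t n) λ ε 0<ε →
  let δ , 0<δ , cδ<ε = scale-below ∣ c ∣ ε (ℚ.0≤∣p∣ c) 0<ε
      N , close = cauchy t δ 0<δ
  in N , λ m n N≤m N≤n → chain (seq t m) (seq t n) δ ε (ℚ.<⇒≤ (close m n N≤m N≤n)) cδ<ε
  where
  chain : ∀ u v δ ε → ∣ u - v ∣ ≤ δ → ∣ c ∣ * δ < ε → ∣ (a + c * u) - (a + c * v) ∣ < ε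
  chain u v δ ε l = ℚ.≤-<-trans {∣ (a + c * u) - (a + c * v) ∣} {∣ c ∣ * δ} {ε}
    (subst (_≤ ∣ c ∣ * δ) (sym (affine-difference a c u v)) (*-mono-≤ (∣ c ∣) (∣ u - v ∣) δ (ℚ.0≤∣p∣ c) l))

ℚ² : Set
ℚ² = ℚ × ℚ

point : ℚ² → Point
point (a , b) = fromℚ a , fromℚ b

module _ (A B : ℚ²) where

  private
    a = proj₁ A
    a′ = proj₂ A
    b = proj₁ B
    b′ = proj₂ B
    c = b - a
    c′ = b′ - a′

  along : Interval → Point
  along t = affine a c (value t) , affine a′ c′ (value t)

  module _ (a≢b : a ≢ b) where

    private
      c≢0 : c ≢ 0ℚ
      c≢0 c≡0 = a≢b (sym (trans (identity a b) (trans (cong (a +_) c≡0) (ℚ.+-identityʳ a))))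
        where
        identity : ∀ a b → b ≡ a + (b - a)
        identity = solve-∀ ℚ-ring

      instance
        c-nonZero : NonZero c
        c-nonZero = ≢-nonZero c≢0

      bound : ∀ d p → ∣ d ∣ ≤ ∣ c ∣ + ∣ c′ ∣ → ∀ s t n →
              ∣ seq (affine p d s) n - seq (affine p d t) n ∣ ≤ (∣ c ∣ + ∣ c′ ∣) * ∣ seq s n - seq t n ∣
      bound d p l s t n = subst (_≤ (∣ c ∣ + ∣ c′ ∣) * ∣ seq s n - seq t n ∣)
        (sym (affine-difference p d (seq s n) (seq t n)))
        (ℚ.*-monoʳ-≤-nonNeg (∣ seq s n - seq t n ∣)
          {{nonNegative (ℚ.0≤∣p∣ (seq s n - seq t n))}} {∣ d ∣} {∣ c ∣ + ∣ c′ ∣} l)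

      unbound : ∀ s t n →
                ∣ seq s n - seq t n ∣ ≤ ∣ 1/ c ∣ * ∣ seq (affine a c s) n - seq (affine a c t) n ∣
      unbound s t n = ℚ.≤-reflexive (sym
        (trans (cong (∣ 1/ c ∣ *_) (affine-difference a c (seq s n) (seq t n)))
        (trans (sym (ℚ.*-assoc (∣ 1/ c ∣) (∣ c ∣) (∣ seq s n - seq t n ∣)))
        (trans (cong (_* ∣ seq s n - seq t n ∣) (trans (sym (ℚ.∣p*q∣≡∣p∣*∣q∣ (1/ c) c)) (cong ∣_∣ (ℚ.*-inverseˡ c))))
               (ℚ.*-identityˡ ∣ seq s n - seq t n ∣)))))

      0≤K : 0ℚ ≤ ∣ c ∣ + ∣ c′ ∣
      0≤K = ℚ.+-mono-≤ {0ℚ} {∣ c ∣} {0ℚ} {∣ c′ ∣} (ℚ.0≤∣p∣ c) (ℚ.0≤∣p∣ c′)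

      ∣c∣≤K : ∣ c ∣ ≤ ∣ c ∣ + ∣ c′ ∣
      ∣c∣≤K = subst (_≤ ∣ c ∣ + ∣ c′ ∣) (ℚ.+-identityʳ ∣ c ∣) (ℚ.+-monoʳ-≤ ∣ c ∣ (ℚ.0≤∣p∣ c′))

      ∣c′∣≤K : ∣ c′ ∣ ≤ ∣ c ∣ + ∣ c′ ∣
      ∣c′∣≤K = subst (_≤ ∣ c ∣ + ∣ c′ ∣) (ℚ.+-identityˡ ∣ c′ ∣) (ℚ.+-monoˡ-≤ ∣ c′ ∣ (ℚ.0≤∣p∣ c))

    -- The path is Lipschitz with constant `∣ c ∣ + ∣ c′ ∣`. Its inverse is read off the first
    -- coordinate alone, with constant `∣ 1/ c ∣`; this is why segments are taken to be
    -- non-vertical.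
    segment : SimpleCurve
    segment = record
      { path = along
      ; continuous = λ t ε 0<ε →
          let δ , 0<δ , f = within-scale (∣ c ∣ + ∣ c′ ∣) ε 0≤K 0<ε in
          δ , 0<δ , λ s near →
            f (value s) (value t) (affine a c (value s)) (affine a c (value t))
              (bound c a ∣c∣≤K (value s) (value t)) near ,
            f (value s) (value t) (affine a′ c′ (value s)) (affine a′ c′ (value t))
              (bound c′ a′ ∣c′∣≤K (value s) (value t)) near
      ; inverse-continuous = λ t ε 0<ε →
          let δ , 0<δ , f = within-scale ∣ 1/ c ∣ ε (ℚ.0≤∣p∣ (1/ c)) 0<ε in
          δ , 0<δ , λ s near →
            f (affine a c (value s)) (affine a c (value t)) (value s) (value t)
              (unbound (value s) (value t)) (proj₁ near)
      }

-- Twice the signed area of the triangle ABP. For distinct A and B it vanishes exactly on the line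
-- AB, and its sign tells the two sides apart.
orient : ℚ² → ℚ² → ℚ² → ℚ
orient (a , a′) (b , b′) (p , p′) = (b - a) * (p′ - a′) - (b′ - a′) * (p - a)

orientₚ : ℚ² → ℚ² → Point → ℕ → ℚ
orientₚ A B (x , y) n = orient A B (seq x n , seq y n)

-- The determinant is affine in its last argument, so along CD it interpolates linearly between its
-- values at C and D. Replacing the point at parameter `t` by the equal point `p` costs only a
-- linear combination of two null coordinate differences.
orient-on : ∀ A B C D t p → along C D t ≈ₚ p →
  Null (λ n → orientₚ A B p n - (orient A B C * (1ℚ - seq (value t) n) + orient A B D * seq (value t) n))
orient-on A@(a , a′) B@(b , b′) C@(c , c′) D@(d , d′) t p@(x , y) (eqx , eqy) = null-cong
  (λ n → identity a a′ b b′ c c′ d d′ (seq (value t) n) (seq x n) (seq y n))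
  (null-+ (null-* (- (b - a)) (≈⇒null {proj₂ (along C D t)} {y} eqy))
          (null-* (b′ - a′) (≈⇒null {proj₁ (along C D t)} {x} eqx)))
  where
  identity : ∀ a a′ b b′ c c′ d d′ t x y →
    - (b - a) * ((c′ + (d′ - c′) * t) - y) + (b′ - a′) * ((c + (d - c) * t) - x) ≡
    ((b - a) * (y - a′) - (b′ - a′) * (x - a)) -
      (((b - a) * (c′ - a′) - (b′ - a′) * (c - a)) * (1ℚ - t) +
       ((b - a) * (d′ - a′) - (b′ - a′) * (d - a)) * t)
  identity = solve-∀ ℚ-ring

-- Two terms that are nonnegative in the limit cannot cancel. Concretely, adding `b * v n` to the
-- negated sum leaves `- (a * u n)`, and `a` can be divided out.
combination-null : ∀ {a b u v} → 0ℚ < a → 0ℚ ≤ b → Nonneg u → Nonneg v →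
                   Null (λ n → a * u n + b * v n) → Null u
combination-null {a} {b} {u} {v} 0<a 0≤b u≥0 v≥0 w = u≥0 ,
  nonneg-cong (λ n → unscale (u n) (v n)) (nonneg-* (1/ a) 0≤1/a (nonneg-+ (nonpos w) (nonneg-* b 0≤b v≥0)))
  where
  instance
    a-positive : Positive a
    a-positive = positive 0<a
    a-nonZero : NonZero a
    a-nonZero = ℚ.pos⇒nonZero a
    1/a-positive : Positive (1/ a)
    1/a-positive = ℚ.1/pos⇒pos a
  0≤1/a : 0ℚ ≤ 1/ a
  0≤1/a = ℚ.<⇒≤ (ℚ.positive⁻¹ (1/ a))
  identity : ∀ r a b u v → r * (- (a * u + b * v) + b * v) ≡ (r * a) * (- u)
  identity = solve-∀ ℚ-ring
  unscale : ∀ u v → 1/ a * (- (a * u + b * v) + b * v) ≡ - u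
  unscale u v = trans (identity (1/ a) a b u v)
    (trans (cong (_* - u) (ℚ.*-inverseˡ a)) (ℚ.*-identityˡ (- u)))

value≥0 : ∀ t → Nonneg (seq (value t))
value≥0 t = mkNonneg (lower t)

value≤1 : ∀ t → Nonneg (λ n → 1ℚ - seq (value t) n)
value≤1 t = mkNonneg λ ε 0<ε → eventually-map (λ n → shift (seq (value t) n) ε) (upper t ε 0<ε)
  where
  identity : ∀ x ε → 1ℚ + ε - x ≡ 1ℚ - x + ε
  identity = solve-∀ ℚ-ring
  shift : ∀ x ε → x ≤ 1ℚ + ε → 0ℚ ≤ 1ℚ - x + ε
  shift x ε l = subst₂ _≤_ (ℚ.+-inverseʳ x) (identity x ε) (ℚ.+-monoˡ-≤ (- x) {x} {1ℚ + ε} l)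

along-start : ∀ A B t → Null (seq (value t)) → along A B t ≈ₚ along A B 0ᴵ
along-start (a , a′) (b , b′) t z = close a b , close a′ b′
  where
  identity : ∀ a b x → (b - a) * x ≡ (a + (b - a) * x) - (a + (b - a) * 0ℚ)
  identity = solve-∀ ℚ-ring
  close : ∀ a b → affine a (b - a) (value t) ≈ affine a (b - a) (value 0ᴵ)
  close a b = null⇒≈ {affine a (b - a) (value t)} {affine a (b - a) (value 0ᴵ)}
    (null-cong (λ n → identity a b (seq (value t) n)) (null-* (b - a) z))

along-end : ∀ A B t → Null (λ n → 1ℚ - seq (value t) n) → along A B t ≈ₚ along A B 1ᴵ
along-end (a , a′) (b , b′) t z = close a b , close a′ b′
  where
  identity : ∀ a b x → - (b - a) * (1ℚ - x) ≡ (a + (b - a) * x) - (a + (b - a) * 1ℚ)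
  identity = solve-∀ ℚ-ring
  close : ∀ a b → affine a (b - a) (value t) ≈ affine a (b - a) (value 1ᴵ)
  close a b = null⇒≈ {affine a (b - a) (value t)} {affine a (b - a) (value 1ᴵ)}
    (null-cong (λ n → identity a b (seq (value t) n)) (null-* (- (b - a)) z))

start-point : ∀ A B → along A B 0ᴵ ≈ₚ point A
start-point (a , a′) (b , b′) = close a b , close a′ b′
  where
  identity : ∀ a b → a + (b - a) * 0ℚ ≡ a
  identity = solve-∀ ℚ-ring
  close : ∀ a b → affine a (b - a) (value 0ᴵ) ≈ fromℚ a
  close a b = ≡⇒≈ {affine a (b - a) (value 0ᴵ)} {fromℚ a} (λ _ → identity a b)

end-point : ∀ A B → along A B 1ᴵ ≈ₚ point B
end-point (a , a′) (b , b′) = close a b , close a′ b′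
  where
  identity : ∀ a b → a + (b - a) * 1ℚ ≡ b
  identity = solve-∀ ℚ-ring
  close : ∀ a b → affine a (b - a) (value 1ᴵ) ≈ fromℚ b
  close a b = ≡⇒≈ {affine a (b - a) (value 1ᴵ)} {fromℚ b} (λ _ → identity a b)

-- The case of `orient-on` in which CD is AB itself, where both interpolated values are 0.
on-line : ∀ {A B} (a≢b : proj₁ A ≢ proj₁ B) {p} → p On segment A B a≢b → Null (orientₚ A B p)
on-line {A@(a , a′)} {B@(b , b′)} a≢b {p@(x , y)} (t , eq) = null-cong
  (λ n → identity a a′ b b′ (seq (value t) n) (seq x n) (seq y n))
  (orient-on A B A B t p eq)
  where
  identity : ∀ a a′ b b′ t x y →
    ((b - a) * (y - a′) - (b′ - a′) * (x - a)) -
      (((b - a) * (a′ - a′) - (b′ - a′) * (a - a)) * (1ℚ - t) +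
       ((b - a) * (b′ - a′) - (b′ - a′) * (b - a)) * t) ≡
    (b - a) * (y - a′) - (b′ - a′) * (x - a)
  identity = solve-∀ ℚ-ring

orient-swap : ∀ A B p → Null (orientₚ A B p) → Null (orientₚ B A p)
orient-swap (a , a′) (b , b′) (x , y) z = null-cong
  (λ n → identity a a′ b b′ (seq x n) (seq y n)) (null-neg z)
  where
  identity : ∀ a a′ b b′ x y → - ((b - a) * (y - a′) - (b′ - a′) * (x - a)) ≡
                               (a - b) * (y - b′) - (a′ - b′) * (x - b)
  identity = solve-∀ ℚ-ring

-- One of C and D may lie on the line AB. This is what lets the criterion apply to edges with a
-- common endpoint.
OnOneSide : ℚ² → ℚ² → ℚ² → ℚ² → Set
OnOneSide A B C D = 0ℚ ≤ orient A B C × 0ℚ ≤ orient A B D × (0ℚ < orient A B C ⊎ 0ℚ < orient A B D)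

-- At parameter t on CD the determinant is (1 - t) g(C) + t g(D) with both terms nonnegative, so it
-- can only vanish when t is 0 or 1.
interior-off-line : ∀ {A B C D} (c≢d : proj₁ C ≢ proj₁ D) {p} → OnOneSide A B C D →
                    p InInterior segment C D c≢d → ¬ Null (orientₚ A B p)
interior-off-line {A} {B} {C} {D} c≢d {p} (0≤C , 0≤D , strict) ((t , eq) , p≉start , p≉end) z =
  [ (λ 0<C → p≉end (≈ₚ-trans {p} {along C D t} {along C D 1ᴵ} (≈ₚ-sym {along C D t} {p} eq)
      (along-end C D t (combination-null 0<C 0≤D (value≤1 t) (value≥0 t) weighted))))
  , (λ 0<D → p≉start (≈ₚ-trans {p} {along C D t} {along C D 0ᴵ} (≈ₚ-sym {along C D t} {p} eq)
      (along-start C D t (combination-null 0<D 0≤C (value≥0 t) (value≤1 t)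
        (null-cong (λ n → ℚ.+-comm (gC * (1ℚ - seq (value t) n)) (gD * seq (value t) n)) weighted)))))
  ]′ strict
  where
  gC = orient A B C
  gD = orient A B D
  cancel : ∀ x y → x - (x - y) ≡ y
  cancel = solve-∀ ℚ-ring
  weighted : Null (λ n → gC * (1ℚ - seq (value t) n) + gD * seq (value t) n)
  weighted = null-cong
    (λ n → cancel (orientₚ A B p n) (gC * (1ℚ - seq (value t) n) + gD * seq (value t) n))
    (null-+ z (null-neg (orient-on A B C D t p eq)))

-- Integer coordinates

ℤ² : Set
ℤ² = ℤ × ℤ

-- Built directly as a fraction with denominator 1, so that the numerator computes back to the given
-- integer.
fromℤ : ℤ → ℚ
fromℤ i = mkℚ i 0 (Coprimality.sym (Coprimality.1-coprimeTo ℤ.∣ i ∣))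

fromℤ² : ℤ² → ℚ²
fromℤ² (i , j) = fromℤ i , fromℤ j

orientℤ : ℤ² → ℤ² → ℤ² → ℤ
orientℤ (a , a′) (b , b′) (p , p′) = (b ℤ.- a) ℤ.* (p′ ℤ.- a′) ℤ.- (b′ ℤ.- a′) ℤ.* (p ℤ.- a)

fromℤ-+ : ∀ i j → fromℤ (i ℤ.+ j) ≡ fromℤ i + fromℤ j
fromℤ-+ i j = sym (trans
  (cong (λ k → k / 1) (cong₂ ℤ._+_ (ℤ.*-identityʳ i) (ℤ.*-identityʳ j)))
  (ℚ.↥p/↧p≡p (fromℤ (i ℤ.+ j))))

fromℤ-* : ∀ i j → fromℤ (i ℤ.* j) ≡ fromℤ i * fromℤ j
fromℤ-* i j = sym (ℚ.↥p/↧p≡p (fromℤ (i ℤ.* j)))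

fromℤ-neg : ∀ i → fromℤ (ℤ.- i) ≡ - fromℤ i
fromℤ-neg (ℤ.+ 0) = refl
fromℤ-neg ℤ.+[1+ n ] = refl
fromℤ-neg ℤ.-[1+ n ] = refl

fromℤ-- : ∀ i j → fromℤ (i ℤ.- j) ≡ fromℤ i - fromℤ j
fromℤ-- i j = trans (fromℤ-+ i (ℤ.- j)) (cong (fromℤ i +_) (fromℤ-neg j))

fromℤ-orient : ∀ A B P → fromℤ (orientℤ A B P) ≡ orient (fromℤ² A) (fromℤ² B) (fromℤ² P)
fromℤ-orient (a , a′) (b , b′) (p , p′) = trans
  (fromℤ-- ((b ℤ.- a) ℤ.* (p′ ℤ.- a′)) ((b′ ℤ.- a′) ℤ.* (p ℤ.- a)))
  (cong₂ _-_ (product b a p′ a′) (product b′ a′ p a))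
  where
  product : ∀ i j k l → fromℤ ((i ℤ.- j) ℤ.* (k ℤ.- l)) ≡ (fromℤ i - fromℤ j) * (fromℤ k - fromℤ l)
  product i j k l = trans (fromℤ-* (i ℤ.- j) (k ℤ.- l)) (cong₂ _*_ (fromℤ-- i j) (fromℤ-- k l))

fromℤ-injective : ∀ {i j} → fromℤ i ≡ fromℤ j → i ≡ j
fromℤ-injective = cong ↥_

fromℤ-≥0 : ∀ {i} → 0ℤ ℤ.≤ i → 0ℚ ≤ fromℤ i
fromℤ-≥0 {i} p = *≤* (subst (0ℤ ℤ.≤_) (sym (ℤ.*-identityʳ i)) p)

fromℤ->0 : ∀ {i} → 0ℤ ℤ.< i → 0ℚ < fromℤ i
fromℤ->0 {i} p = *<* (subst (0ℤ ℤ.<_) (sym (ℤ.*-identityʳ i)) p)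

-- Straight-line drawings

OnOneSideℤ : ℤ² → ℤ² → ℤ² → ℤ² → Set
OnOneSideℤ A B C D =
  0ℤ ℤ.≤ orientℤ A B C × 0ℤ ℤ.≤ orientℤ A B D × (0ℤ ℤ.< orientℤ A B C ⊎ 0ℤ ℤ.< orientℤ A B D)

-- Exchanging A and B negates the determinant, so the two cases are the two sides of the line AB.
SplitBy : ℤ² → ℤ² → ℤ² → ℤ² → Set
SplitBy A B C D = OnOneSideℤ A B C D ⊎ OnOneSideℤ B A C D

fromℤ-OnOneSide : ∀ A B C D → OnOneSideℤ A B C D → OnOneSide (fromℤ² A) (fromℤ² B) (fromℤ² C) (fromℤ² D)
fromℤ-OnOneSide A B C D (p , q , r) =
  subst (0ℚ ≤_) (fromℤ-orient A B C) (fromℤ-≥0 p) ,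
  subst (0ℚ ≤_) (fromℤ-orient A B D) (fromℤ-≥0 q) ,
  Sum.map (subst (0ℚ <_) (fromℤ-orient A B C) ∘ fromℤ->0)
          (subst (0ℚ <_) (fromℤ-orient A B D) ∘ fromℤ->0) r

segmentℤ : (A B : ℤ²) → proj₁ A ≢ proj₁ B → SimpleCurve
segmentℤ A B A≢B = segment (fromℤ² A) (fromℤ² B) (A≢B ∘ fromℤ-injective)

pointℤ : ℤ² → Point
pointℤ A = point (fromℤ² A)

-- A common interior point would lie on the line AB, and there the interior of CD has no points.
split⇒disjoint : ∀ A B C D A≢B C≢D → SplitBy A B C D →
                 DisjointInteriors (segmentℤ A B A≢B) (segmentℤ C D C≢D)
split⇒disjoint A B C D A≢B C≢D (inj₁ side) (p , (onAB , _) , inCD) =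
  interior-off-line {fromℤ² A} {fromℤ² B} {fromℤ² C} {fromℤ² D} (C≢D ∘ fromℤ-injective) {p}
    (fromℤ-OnOneSide A B C D side) inCD
    (on-line {fromℤ² A} {fromℤ² B} (A≢B ∘ fromℤ-injective) {p} onAB)
split⇒disjoint A B C D A≢B C≢D (inj₂ side) (p , (onAB , _) , inCD) =
  interior-off-line {fromℤ² B} {fromℤ² A} {fromℤ² C} {fromℤ² D} (C≢D ∘ fromℤ-injective) {p}
    (fromℤ-OnOneSide B A C D side) inCD
    (orient-swap (fromℤ² A) (fromℤ² B) p
      (on-line {fromℤ² A} {fromℤ² B} (A≢B ∘ fromℤ-injective) {p} onAB))

disjoint-sym : ∀ {γ δ} → DisjointInteriors γ δ → DisjointInteriors δ γ
disjoint-sym d (p , a , b) = d (p , b , a)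

on-segment⇒collinear : ∀ A B P A≢B → pointℤ P On segmentℤ A B A≢B → orientℤ A B P ≡ 0ℤ
on-segment⇒collinear A B P A≢B on = fromℤ-injective (trans (fromℤ-orient A B P)
  (null-const (on-line {fromℤ² A} {fromℤ² B} (A≢B ∘ fromℤ-injective) {pointℤ P} on)))

pointℤ-injective₁ : ∀ A B → pointℤ A ≈ₚ pointℤ B → proj₁ A ≡ proj₁ B
pointℤ-injective₁ (a , _) (b , _) (eq , _) = fromℤ-injective
  (difference-zero (null-const (≈⇒null {fromℚ (fromℤ a)} {fromℚ (fromℤ b)} eq)))
  where
  identity : ∀ p q → p ≡ p - q + q
  identity = solve-∀ ℚ-ring
  difference-zero : ∀ {p q} → p - q ≡ 0ℚ → p ≡ q
  difference-zero {p} {q} d = trans (identity p q) (trans (cong (_+ q) d) (ℚ.+-identityˡ q))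

bipartite : ∀ {n m} → (Fin n → Fin m → Bool) → Graph (Fin n ⊎ Fin m)
bipartite inc = record
  { adj = λ { (inj₁ x) (inj₂ y) → inc x y
            ; (inj₂ y) (inj₁ x) → inc x y
            ; (inj₁ _) (inj₁ _) → false
            ; (inj₂ _) (inj₂ _) → false }
  ; symmetric = λ { (inj₁ _) (inj₁ _) → refl
                  ; (inj₁ _) (inj₂ _) → refl
                  ; (inj₂ _) (inj₁ _) → refl
                  ; (inj₂ _) (inj₂ _) → refl }
  ; loopless = λ { (inj₁ _) → refl ; (inj₂ _) → refl }
  }

-- For concrete coordinates all three hypotheses are decidable by integer arithmetic. Distinct
-- columns make positions distinct and edges non-vertical. Collinearity is tested against the whole
-- line of an edge, so that a single determinant decides it.
module StraightLine {n m} (inc : Fin n → Fin m → Bool) (loc : Fin n ⊎ Fin m → ℤ²)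
  (columns-distinct : ∀ u v → proj₁ (loc u) ≡ proj₁ (loc v) → u ≡ v)
  (no-three-collinear : ∀ x y w → T (inc x y) →
    orientℤ (loc (inj₁ x)) (loc (inj₂ y)) (loc w) ≡ 0ℤ → w ≡ inj₁ x ⊎ w ≡ inj₂ y)
  (split : ∀ x y x′ y′ → T (inc x y) → T (inc x′ y′) → ¬ (x ≡ x′ × y ≡ y′) →
    SplitBy (loc (inj₁ x)) (loc (inj₂ y)) (loc (inj₁ x′)) (loc (inj₂ y′)) ⊎
    SplitBy (loc (inj₁ x′)) (loc (inj₂ y′)) (loc (inj₁ x)) (loc (inj₂ y))) where

  column≢ : ∀ x y → proj₁ (loc (inj₁ x)) ≢ proj₁ (loc (inj₂ y))
  column≢ x y eq with () ← columns-distinct (inj₁ x) (inj₂ y) eq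

  edge : Fin n → Fin m → SimpleCurve
  edge x y = segmentℤ (loc (inj₁ x)) (loc (inj₂ y)) (column≢ x y)

  place : Fin n ⊎ Fin m → Point
  place = pointℤ ∘ loc

  edge-start : ∀ x y → start (edge x y) ≈ₚ place (inj₁ x)
  edge-start x y = start-point (fromℤ² (loc (inj₁ x))) (fromℤ² (loc (inj₂ y)))

  edge-end : ∀ x y → end (edge x y) ≈ₚ place (inj₂ y)
  edge-end x y = end-point (fromℤ² (loc (inj₁ x))) (fromℤ² (loc (inj₂ y)))

  edge-avoids : ∀ x y → T (inc x y) → ∀ w → ¬ (place w InInterior edge x y)
  edge-avoids x y e w (on , ≉start , ≉end) =
    [ (λ { refl → ≉start (≈ₚ-sym {start (edge x y)} {place w} (edge-start x y)) })
    , (λ { refl → ≉end (≈ₚ-sym {end (edge x y)} {place w} (edge-end x y)) })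
    ]′ (no-three-collinear x y w e
         (on-segment⇒collinear (loc (inj₁ x)) (loc (inj₂ y)) (loc w) (column≢ x y) on))

  edges-disjoint : ∀ x y x′ y′ → T (inc x y) → T (inc x′ y′) → ¬ (x ≡ x′ × y ≡ y′) →
                   DisjointInteriors (edge x y) (edge x′ y′)
  edges-disjoint x y x′ y′ e e′ distinct =
    [ split⇒disjoint (loc (inj₁ x)) (loc (inj₂ y)) (loc (inj₁ x′)) (loc (inj₂ y′)) (column≢ x y) (column≢ x′ y′)
    , disjoint-sym {edge x′ y′} {edge x y} ∘
      split⇒disjoint (loc (inj₁ x′)) (loc (inj₂ y′)) (loc (inj₁ x)) (loc (inj₂ y)) (column≢ x′ y′) (column≢ x y)
    ]′ (split x y x′ y′ e e′ distinct)

  drawing : PlaneDrawing (bipartite inc)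
  drawing = record
    { position          = place
    ; position-distinct = λ u v u≢v eq → u≢v (columns-distinct u v (pointℤ-injective₁ (loc u) (loc v) eq))
    ; arc               = λ { (inj₁ x) (inj₂ y) _ → edge x y ; (inj₂ y) (inj₁ x) _ → edge x y }
    ; arc-reverse       = λ { (inj₁ x) (inj₂ y) _ _ _ on → on ; (inj₂ y) (inj₁ x) _ _ _ on → on }
    ; arc-ends          = λ { (inj₁ x) (inj₂ y) _ → inj₁ (edge-start x y , edge-end x y)
                            ; (inj₂ y) (inj₁ x) _ → inj₂ (edge-start x y , edge-end x y) }
    ; arc-avoids        = λ { (inj₁ x) (inj₂ y) e → edge-avoids x y e
                            ; (inj₂ y) (inj₁ x) e → edge-avoids x y e }
    ; arcs-disjoint     = λ
      { (inj₁ x) (inj₂ y) e (inj₁ x′) (inj₂ y′) e′ distinct → edges-disjoint x y x′ y′ e e′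
          λ { (refl , refl) → distinct (inj₁ (refl , refl)) }
      ; (inj₁ x) (inj₂ y) e (inj₂ y′) (inj₁ x′) e′ distinct → edges-disjoint x y x′ y′ e e′
          λ { (refl , refl) → distinct (inj₂ (refl , refl)) }
      ; (inj₂ y) (inj₁ x) e (inj₁ x′) (inj₂ y′) e′ distinct → edges-disjoint x y x′ y′ e e′
          λ { (refl , refl) → distinct (inj₂ (refl , refl)) }
      ; (inj₂ y) (inj₁ x) e (inj₂ y′) (inj₁ x′) e′ distinct → edges-disjoint x y x′ y′ e e′
          λ { (refl , refl) → distinct (inj₁ (refl , refl)) } }
    }

all-vertices? : ∀ {n m} {P : Fin n ⊎ Fin m → Set} → (∀ v → Dec (P v)) → Dec (∀ v → P v)
all-vertices? P? = map′ (λ (f , g) → λ { (inj₁ x) → f x ; (inj₂ y) → g y })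
                        (λ h → (λ x → h (inj₁ x)) , λ y → h (inj₂ y))
                        (Fin.all? (λ x → P? (inj₁ x)) ×-dec Fin.all? (λ y → P? (inj₂ y)))

split? : ∀ A B C D → Dec (SplitBy A B C D)
split? A B C D = oneSide? A B C D ⊎-dec oneSide? B A C D
  where
  oneSide? : ∀ A B C D → Dec (OnOneSideℤ A B C D)
  oneSide? A B C D = 0ℤ ℤ.≤? orientℤ A B C ×-dec 0ℤ ℤ.≤? orientℤ A B D ×-dec
                     (0ℤ ℤ.<? orientℤ A B C ⊎-dec 0ℤ ℤ.<? orientℤ A B D)

-- Contact graphs

module Counting {B : Set} {_~_ : Rel B 0ℓ} (_~?_ : Decidable _~_)
                (~-refl : Reflexive _~_) (~-sym : Symmetric _~_) (~-trans : Transitive _~_) where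

  count : B → List B → ℕ
  count k = length ∘ filter (k ~?_)

  count-∷ : ∀ k {x y xs ys} → x ~ y → count k xs ≡ count k ys → count k (x ∷ xs) ≡ count k (y ∷ ys)
  count-∷ k {x} {y} x~y eq with k ~? x | k ~? y
  ... | yes _   | yes _   = cong suc eq
  ... | no  _   | no  _   = eq
  ... | yes k~x | no  k≁y = contradiction (~-trans k~x x~y) k≁y
  ... | no  k≁x | yes k~y = contradiction (~-trans k~y (~-sym x~y)) k≁x

  count-swap : ∀ k x y xs → count k (x ∷ y ∷ xs) ≡ count k (y ∷ x ∷ xs)
  count-swap k x y xs with k ~? x in p | k ~? y in q
  ... | yes _ | yes _ rewrite p | q = refl
  ... | yes _ | no  _ rewrite p | q = refl
  ... | no  _ | yes _ rewrite p | q = refl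
  ... | no  _ | no  _ rewrite p | q = refl

  -- The first element of `ys` equivalent to `x` is removed; counts cannot distinguish it from `x`.
  extract : ∀ x ys → 1 ℕ.≤ count x ys →
            ∃[ zs ] (length ys ≡ suc (length zs) × (∀ k → count k ys ≡ count k (x ∷ zs)))
  extract x (y ∷ ys) p with x ~? y
  ... | yes x~y = ys , refl , λ k → count-∷ k (~-sym x~y) refl
  ... | no  x≁y with zs , len , same ← extract x ys p =
    y ∷ zs , cong suc len , λ k →
      trans (count-∷ k {xs = ys} {ys = x ∷ zs} ~-refl (same k)) (count-swap k y x zs)

  count-accept : ∀ k x xs → k ~ x → count k (x ∷ xs) ≡ suc (count k xs)
  count-accept k x xs k~x = cong length (filter-accept (k ~?_) k~x)

  count-weaken : ∀ k x xs → count k xs ℕ.≤ count k (x ∷ xs)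
  count-weaken k x xs with k ~? x
  ... | yes _ = ℕ.n≤1+n _
  ... | no  _ = ℕ.≤-refl

  count-cancel : ∀ k x {xs ys} → count k (x ∷ xs) ℕ.≤ count k (x ∷ ys) → count k xs ℕ.≤ count k ys
  count-cancel k x p with k ~? x
  ... | yes _ = s≤s⁻¹ p
  ... | no  _ = p

  -- A comparison class by class yields a comparison of totals, without listing the classes: each
  -- head of `xs` is matched with an equivalent member of `ys`, and both are cancelled.
  length-mono : ∀ xs ys → (∀ k → count k xs ℕ.≤ count k ys) → length xs ℕ.≤ length ys
  length-mono []       ys le = z≤n
  length-mono (x ∷ xs) ys le
    with zs , len , same ← extract x ys
           (ℕ.≤-trans (s≤s z≤n) (subst (ℕ._≤ count x ys) (count-accept x x xs ~-refl) (le x))) =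
    subst (suc (length xs) ℕ.≤_) (sym len) (s≤s (length-mono xs zs λ k →
      count-cancel k x {xs} {zs} (subst (count k (x ∷ xs) ℕ.≤_) (same k) (le k))))

-- Enumeration of cliques

module _ {V : Set} (G : Graph V) where

  -- A separate function, so that the recursive value is shared when the enumeration is evaluated.
  withVertex : V → List (List V) → List (List V)
  withVertex v Cs = Cs ++ map (v ∷_) (filterᵇ (all (adj G v)) Cs)

  cliques : List V → List (List V)
  cliques []       = [] ∷ []
  cliques (v ∷ vs) = withVertex v (cliques vs)

  -- Completeness of the enumeration: a check over the finite list `cliques` thereby reaches every
  -- clique formed by the strings through a point.
  ∈-cliques : ∀ {C vs} → C ⊆ vs → AllPairs (Adj G) C → C ∈ cliques vs
  ∈-cliques []          _             = here refl
  ∈-cliques (v ∷ʳ C⊆vs) clique        = ∈-++⁺ˡ (∈-cliques C⊆vs clique)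
  ∈-cliques (_∷_ {x = v} {ys = vs} refl C⊆vs) (adjacent ∷ clique) =
    ∈-++⁺ʳ (cliques vs) (∈-map⁺ (v ∷_)
      (∈-filter⁺ (T? ∘ all (adj G v)) (∈-cliques C⊆vs clique) (all-T adjacent)))
    where
    all-T : ∀ {xs} → All (Adj G v) xs → T (all (adj G v) xs)
    all-T []                          = _
    all-T {x ∷ _} (a ∷ as) with adj G v x
    ... | true = all-T as

allPairs-All : ∀ {A : Set} {P : Pred A 0ℓ} {R S : Rel A 0ℓ} → (∀ {x y} → P x → P y → R x y → S x y) →
               ∀ {xs} → All P xs → AllPairs R xs → AllPairs S xs
allPairs-All f []         []         = []
allPairs-All f (px ∷ pxs) (rx ∷ rxs) =
  All.zipWith (λ (py , r) → f px py r) (pxs , rx) ∷ allPairs-All f pxs rxs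

-- Serves to pass from counting edges paired with their covering slots to counting the edges alone.
length-filter-toList : ∀ {A : Set} {P R : Pred A 0ℓ} {Q : Pred (Σ A P) 0ℓ}
  (Q? : Decidable₁ Q) (R? : Decidable₁ R) → (∀ {x} (px : P x) → Q (x , px) → R x) →
  ∀ {xs} (pxs : All P xs) → length (filter Q? (All.toList pxs)) ℕ.≤ length (filter R? xs)
length-filter-toList Q? R? f []                    = z≤n
length-filter-toList Q? R? f (_∷_ {x = x} px pxs) with Q? (x , px) | R? x
... | yes _ | yes _ = s≤s (length-filter-toList Q? R? f pxs)
... | yes q | no ¬r = contradiction (f px q) ¬r
... | no  _ | yes _ = ℕ.m≤n⇒m≤1+n (length-filter-toList Q? R? f pxs)
... | no  _ | no  _ = length-filter-toList Q? R? f pxs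

length-toList : ∀ {A : Set} {P : Pred A 0ℓ} {xs} (pxs : All P xs) → length (All.toList pxs) ≡ length xs
length-toList []         = refl
length-toList (px ∷ pxs) = cong suc (length-toList pxs)

length-filter-map : ∀ {A B : Set} {P : Pred B 0ℓ} (P? : Decidable₁ P) (f : A → B) xs →
                    length (filter P? (map f xs)) ≡ length (filter (P? ∘ f) xs)
length-filter-map P? f []       = refl
length-filter-map P? f (x ∷ xs) with P? (f x)
... | yes _ = cong suc (length-filter-map P? f xs)
... | no  _ = length-filter-map P? f xs

inside : ∀ {n} → List (Fin n) → List (Fin n × Fin n) → List (Fin n × Fin n)
inside C = filter λ (u , v) → _∈?_ _≟_ u C ×-dec _∈?_ _≟_ v C

Slot : ℕ → Set
Slot n = Fin n × Bool

slots : ∀ {n} → List (Fin n) → List (Slot n)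
slots js = cartesianProduct js (true ∷ false ∷ [])

length-slots : ∀ {n} (js : List (Fin n)) → length (slots js) ≡ length js ℕ.* 2
length-slots []       = refl
length-slots (j ∷ js) = cong (suc ∘ suc) (length-slots js)

-- Counting the endpoints of strings

module _ (em : ExcludedMiddle 0ℓ) {n} (G : Graph (Fin n))
         (strings : ContactStringGraph G) where

  γ : Fin n → SimpleCurve
  γ = proj₁ strings

  disjoint : ∀ i j → i ≢ j → DisjointInteriors (γ i) (γ j)
  disjoint = proj₁ (proj₂ strings)

  contact : ∀ i j → i ≢ j → Adj G i j ⇔ Intersect (γ i) (γ j)
  contact = proj₂ (proj₂ strings)

  endpoint : Slot n → Point
  endpoint (j , true)  = start (γ j)
  endpoint (j , false) = end (γ j)

  _~_ : Rel (Slot n) 0ℓ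
  s ~ t = endpoint s ≈ₚ endpoint t

  -- Equality of real points is decided classically. Excluded middle enters here, in `on?` and in
  -- `interior-or-endpoint`.
  _~?_ : Decidable _~_
  s ~? t = em

  open Counting {_~_ = _~_} _~?_ (λ {s} → ≈ₚ-refl {endpoint s})
    (λ {s} {t} → ≈ₚ-sym {endpoint s} {endpoint t})
    (λ {s} {t} {u} → ≈ₚ-trans {endpoint s} {endpoint t} {endpoint u})

  on? : ∀ s → Decidable₁ (λ j → endpoint s On γ j)
  on? s j = em

  through : Slot n → List (Fin n) → List (Fin n)
  through s = filter (on? s)

  On-resp : ∀ {p q} i → p ≈ₚ q → p On γ i → q On γ i
  On-resp {p} {q} i p≈q (t , eq) = t , ≈ₚ-trans {path (γ i) t} {p} {q} eq p≈q

  Covering : Fin n × Fin n → Set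
  Covering (u , v) = ∃[ s ] (endpoint s On γ u × endpoint s On γ v)

  endpoint-On : ∀ i b → endpoint (i , b) On γ i
  endpoint-On i true  = 0ᴵ , ≈ₚ-refl {start (γ i)}
  endpoint-On i false = 1ᴵ , ≈ₚ-refl {end (γ i)}

  interior-or-endpoint : ∀ p i → p On γ i → p InInterior γ i ⊎ ∃[ b ] (p ≈ₚ endpoint (i , b))
  interior-or-endpoint p i on = classify em em
    where
    classify : Dec (p ≈ₚ start (γ i)) → Dec (p ≈ₚ end (γ i)) →
               p InInterior γ i ⊎ ∃[ b ] (p ≈ₚ endpoint (i , b))
    classify (yes p≈start) _           = inj₂ (true , p≈start)
    classify (no _)        (yes p≈end) = inj₂ (false , p≈end)
    classify (no p≉start)  (no p≉end)  = inj₁ (on , p≉start , p≉end)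

  adjacent⇒≢ : ∀ {u v} → Adj G u v → u ≢ v
  adjacent⇒≢ {u} a refl = subst T (loopless G u) a

  covering : ∀ {e} → Adj G (proj₁ e) (proj₂ e) → Covering e
  covering {u , v} a = choose (interior-or-endpoint p u onu) (interior-or-endpoint p v onv)
    where
    u≢v = adjacent⇒≢ a
    meeting : Intersect (γ u) (γ v)
    meeting = Equivalence.to (contact u v u≢v) a
    p = proj₁ meeting
    onu = proj₁ (proj₂ meeting)
    onv = proj₂ (proj₂ meeting)
    choose : p InInterior γ u ⊎ ∃[ b ] (p ≈ₚ endpoint (u , b)) →
             p InInterior γ v ⊎ ∃[ b ] (p ≈ₚ endpoint (v , b)) → Covering (u , v)
    choose (inj₂ (b , eq)) _               =
      (u , b) , endpoint-On u b , On-resp {p} {endpoint (u , b)} v eq onv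
    choose (inj₁ _)        (inj₂ (b , eq)) =
      (v , b) , On-resp {p} {endpoint (v , b)} u eq onu , endpoint-On v b
    choose (inj₁ inu)      (inj₁ inv)      = contradiction (p , inu , inv) (disjoint u v u≢v)

  -- Any two of these strings meet at `endpoint s`; they are distinct because `allFin` has no
  -- repetitions.
  through-clique : ∀ s → AllPairs (Adj G) (through s (allFin n))
  through-clique s = allPairs-All
    (λ {i} {j} oni onj i≢j → Equivalence.from (contact i j i≢j) (endpoint s , oni , onj))
    (All.all-filter (on? s) (allFin n))
    (Unique.filter⁺ (on? s) (Unique.allFin⁺ n))

  count-slots-∷ : ∀ s j b js → endpoint s ≈ₚ endpoint (j , b) →
                  suc (count s (slots js)) ℕ.≤ count s (slots (j ∷ js))
  count-slots-∷ s j true  js eq = ℕ.≤-trans (s≤s (count-weaken s (j , false) (slots js)))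
    (ℕ.≤-reflexive (sym (count-accept s (j , true) ((j , false) ∷ slots js) eq)))
  count-slots-∷ s j false js eq = ℕ.≤-trans
    (ℕ.≤-reflexive (sym (count-accept s (j , false) (slots js) eq)))
    (count-weaken s (j , true) ((j , false) ∷ slots js))

  count-slots-mono : ∀ s j js → count s (slots js) ℕ.≤ count s (slots (j ∷ js))
  count-slots-mono s j js = ℕ.≤-trans (count-weaken s (j , false) (slots js))
    (count-weaken s (j , true) ((j , false) ∷ slots js))

  through≤slots : ∀ s js → All (λ j → ¬ endpoint s InInterior γ j) js →
                  length (through s js) ℕ.≤ count s (slots js)
  through≤slots s []       []            = z≤n
  through≤slots s (j ∷ js) (¬inj ∷ ¬injs) with on? s j
  ... | no  _  = ℕ.≤-trans (through≤slots s js ¬injs) (count-slots-mono s j js)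
  ... | yes on = [ (λ inj → contradiction inj ¬inj)
                 , (λ (b , eq) → ℕ.≤-trans (s≤s (through≤slots s js ¬injs)) (count-slots-∷ s j b js eq))
                 ]′ (interior-or-endpoint (endpoint s) j on)

  -- Every string through the point ends there, and so supplies a slot, unless the point is interior
  -- to it. By disjointness of interiors at most one string is such an exception; once it is met,
  -- `through≤slots` handles the remaining ones without loss.
  through∸1≤slots : ∀ s js → Unique js → length (through s js) ∸ 1 ℕ.≤ count s (slots js)
  -- The induction keeps the 1 on the right, away from truncated subtraction.
  through∸1≤slots s js unique = ℕ.m≤n+o⇒m∸n≤o _ 1 (go js unique)
    where
    go : ∀ js → Unique js → length (through s js) ℕ.≤ suc (count s (slots js))
    go []       []               = z≤n
    go (j ∷ js) (j∉js ∷ unique) with on? s j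
    ... | no  _  = ℕ.≤-trans (go js unique) (s≤s (count-slots-mono s j js))
    ... | yes on = s≤s (
      [ (λ inj → ℕ.≤-trans
          (through≤slots s js (All.map (λ {k} j≢k ink → disjoint j k j≢k (endpoint s , inj , ink)) j∉js))
          (count-slots-mono s j js))
      , (λ (b , eq) → ℕ.≤-trans (go js unique) (count-slots-∷ s j b js eq))
      ]′ (interior-or-endpoint (endpoint s) j on))

  -- Each edge is charged to its `chosen` slot. At every point the charges are bounded by the edges
  -- of `M` inside the clique of strings through it, hence by the number of slots there;
  -- `length-mono` then compares the totals.
  forest-size : ∀ M → All (λ e → Adj G (proj₁ e) (proj₂ e)) M →
                All (λ C → length (inside C M) ℕ.≤ length C ∸ 1) (cliques G (allFin n)) →
                length M ℕ.≤ n ℕ.* 2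
  forest-size M edges forest = begin
    length M                    ≡⟨ length-toList covered ⟨
    length (All.toList covered) ≡⟨ length-map chosen (All.toList covered) ⟨
    length (map chosen (All.toList covered))
      ≤⟨ length-mono (map chosen (All.toList covered)) (slots (allFin n)) bound ⟩
    length (slots (allFin n))   ≡⟨ length-slots (allFin n) ⟩
    length (allFin n) ℕ.* 2     ≡⟨ cong (ℕ._* 2) (length-tabulate {n = n} (λ i → i)) ⟩
    n ℕ.* 2                     ∎
    where
    open ℕ.≤-Reasoning
    covered : All Covering M
    covered = All.map covering edges
    chosen : Σ (Fin n × Fin n) Covering → Slot n
    chosen (_ , s , _) = s
    bound : ∀ s → count s (map chosen (All.toList covered)) ℕ.≤ count s (slots (allFin n))
    bound s = begin
      count s (map chosen (All.toList covered))
        ≡⟨ length-filter-map (s ~?_) chosen (All.toList covered) ⟩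
      length (filter (λ c → s ~? chosen c) (All.toList covered))
        -- An edge charged to a slot at the point of `s` has both of its strings passing through
        -- that point.
        ≤⟨ length-filter-toList (λ c → s ~? chosen c) _
             (λ { {u , v} (t , onu , onv) s~t → member u t s~t onu , member v t s~t onv }) covered ⟩
      length (inside (through s (allFin n)) M)
        ≤⟨ All.lookup forest (∈-cliques G (filter-⊆ (on? s) (allFin n)) (through-clique s)) ⟩
      length (through s (allFin n)) ∸ 1
        ≤⟨ through∸1≤slots s (allFin n) (Unique.allFin⁺ n) ⟩
      count s (slots (allFin n)) ∎
      where
      member : ∀ u t → s ~ t → endpoint t On γ u → u ∈ through s (allFin n)
      member u t s~t on = ∈-filter⁺ (on? s) (∈-allFin u)
        (On-resp {endpoint t} {endpoint s} u (≈ₚ-sym {endpoint s} {endpoint t} s~t) on)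

-- The example

commonPoint? : ∀ {n m} (inc : Fin n → Fin m → Bool) x x′ → Dec (∃[ y ] (T (inc x y) × T (inc x′ y)))
commonPoint? inc x x′ = Fin.any? λ y → T? (inc x y) ×-dec T? (inc x′ y)

-- The nations are the first side of the bipartite graph, and inc is its adjacency.
mapGraph : ∀ {n m} → (Fin n → Fin m → Bool) → Graph (Fin n)
mapGraph inc = record
  { adj       = λ x x′ → does (adjacent? x x′)
  ; symmetric = λ x x′ → does-⇔ (mk⇔ swap swap) (adjacent? x x′) (adjacent? x′ x)
  ; loopless  = λ x → dec-false (adjacent? x x) λ (x≢x , _) → x≢x refl
  }
  where
  Adjacent : _ → _ → Set
  Adjacent x x′ = x ≢ x′ × ∃[ y ] (T (inc x y) × T (inc x′ y))
  adjacent? : ∀ x x′ → Dec (Adjacent x x′)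
  adjacent? x x′ = ¬? (x ≟ x′) ×-dec commonPoint? inc x x′
  swap : ∀ {x x′} → Adjacent x x′ → Adjacent x′ x
  swap (x≢x′ , y , p , q) = x≢x′ ∘ sym , y , q , p

mapGraph-adjacent : ∀ {n m} (inc : Fin n → Fin m → Bool) x x′ → x ≢ x′ →
                    Adj (mapGraph inc) x x′ ⇔ (∃[ y ] (T (inc x y) × T (inc x′ y)))
mapGraph-adjacent inc x x′ x≢x′ with x ≟ x′ | commonPoint? inc x x′
... | yes x≡x′ | _     = contradiction x≡x′ x≢x′
... | no  _    | yes c = mk⇔ (λ _ → c) (λ _ → tt)
... | no  _    | no ¬c = mk⇔ (λ ()) ¬c

mapGraph-zeroMap : ∀ {n m} (inc : Fin n → Fin m → Bool) → Planar (bipartite inc) →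
                   ZeroMapGraph (mapGraph inc)
mapGraph-zeroMap {m = m} inc planar =
  m , bipartite inc , ((λ _ _ ()) , (λ _ _ ())) , planar , mapGraph-adjacent inc

pattern ■ = true
pattern □ = false

-- Rows are nations and columns are the points where they meet. The 42 incidences attain the maximum
-- 2 * 23 - 4 for a planar bipartite graph on 23 vertices.
incidence : Vec (Vec Bool 7) 16
incidence =
    (■ ∷ ■ ∷ □ ∷ □ ∷ □ ∷ □ ∷ ■ ∷ [])
  ∷ (■ ∷ ■ ∷ □ ∷ □ ∷ ■ ∷ □ ∷ □ ∷ [])
  ∷ (□ ∷ ■ ∷ ■ ∷ ■ ∷ ■ ∷ □ ∷ □ ∷ [])
  ∷ (□ ∷ □ ∷ ■ ∷ ■ ∷ □ ∷ □ ∷ □ ∷ [])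
  ∷ (□ ∷ □ ∷ ■ ∷ ■ ∷ □ ∷ ■ ∷ □ ∷ [])
  ∷ (□ ∷ □ ∷ ■ ∷ □ ∷ □ ∷ ■ ∷ □ ∷ [])
  ∷ (□ ∷ ■ ∷ ■ ∷ □ ∷ □ ∷ ■ ∷ ■ ∷ [])
  ∷ (□ ∷ ■ ∷ □ ∷ □ ∷ □ ∷ □ ∷ ■ ∷ [])
  ∷ (■ ∷ □ ∷ □ ∷ □ ∷ ■ ∷ □ ∷ □ ∷ [])
  ∷ (■ ∷ □ ∷ □ ∷ □ ∷ ■ ∷ □ ∷ □ ∷ [])
  ∷ (■ ∷ □ ∷ □ ∷ ■ ∷ ■ ∷ ■ ∷ □ ∷ [])
  ∷ (□ ∷ □ ∷ □ ∷ ■ ∷ □ ∷ ■ ∷ □ ∷ [])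
  ∷ (■ ∷ □ ∷ □ ∷ □ ∷ □ ∷ ■ ∷ ■ ∷ [])
  ∷ (□ ∷ ■ ∷ ■ ∷ □ ∷ □ ∷ □ ∷ □ ∷ [])
  ∷ (□ ∷ □ ∷ □ ∷ ■ ∷ ■ ∷ □ ∷ □ ∷ [])
  ∷ (□ ∷ □ ∷ □ ∷ □ ∷ □ ∷ ■ ∷ ■ ∷ [])
  ∷ []

-- Together with `pointGrid`, the first coordinates are the numbers 0 to 22, each used once.
nationGrid : Vec (ℕ × ℕ) 16
nationGrid =
  (1 , 2) ∷ (22 , 14) ∷ (12 , 13) ∷ (13 , 11) ∷ (9 , 10) ∷ (6 , 9) ∷ (3 , 7) ∷ (4 , 5) ∷ (18 , 4) ∷
  (19 , 4) ∷ (14 , 3) ∷ (10 , 8) ∷ (15 , 1) ∷ (2 , 9) ∷ (16 , 7) ∷ (11 , 6) ∷ []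

pointGrid : Vec (ℕ × ℕ) 7
pointGrid =
  (21 , 0) ∷ (0 , 12) ∷ (5 , 11) ∷ (17 , 5) ∷ (20 , 5) ∷ (8 , 10) ∷ (7 , 3) ∷ []

-- Found by computer search.  Every set of pairwise adjacent vertices counts as a clique below, so the
-- bound |C| - 1 amounts to these edges forming a forest on each clique.
forest : List (Fin 16 × Fin 16)
forest = map (λ (i , j) → i mod 16 , j mod 16) pairs
  where
  pairs : List (ℕ × ℕ)
  pairs =
    (0 , 8) ∷ (0 , 13) ∷ (0 , 15) ∷ (1 , 6) ∷ (1 , 12) ∷ (1 , 13) ∷ (1 , 14) ∷ (2 , 5) ∷ (2 , 7) ∷
    (2 , 9) ∷ (2 , 11) ∷ (3 , 6) ∷ (3 , 10) ∷ (3 , 13) ∷ (3 , 14) ∷ (4 , 12) ∷ (4 , 13) ∷ (4 , 14) ∷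
    (4 , 15) ∷ (5 , 13) ∷ (5 , 15) ∷ (6 , 11) ∷ (7 , 12) ∷ (7 , 13) ∷ (7 , 15) ∷ (8 , 12) ∷ (8 , 14) ∷
    (9 , 10) ∷ (9 , 12) ∷ (9 , 14) ∷ (10 , 15) ∷ (11 , 12) ∷ (11 , 14) ∷ []

incident : Fin 16 → Fin 7 → Bool
incident x y = lookup (lookup incidence x) y

location : Fin 16 ⊎ Fin 7 → ℤ²
location = [ grid ∘ lookup nationGrid , grid ∘ lookup pointGrid ]′
  where
  grid : ℕ × ℕ → ℤ²
  grid (i , j) = ℤ.+ i , ℤ.+ j

_≟ᵥ_ : (u v : Fin 16 ⊎ Fin 7) → Dec (u ≡ v)
_≟ᵥ_ = ≡-dec _≟_ _≟_

columns-distinct : ∀ u v → proj₁ (location u) ≡ proj₁ (location v) → u ≡ v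
columns-distinct = toWitness {a? = all-vertices? λ u → all-vertices? λ v →
  proj₁ (location u) ℤ.≟ proj₁ (location v) →-dec (u ≟ᵥ v)} tt

no-three-collinear : ∀ x y w → T (incident x y) →
    orientℤ (location (inj₁ x)) (location (inj₂ y)) (location w) ≡ 0ℤ → w ≡ inj₁ x ⊎ w ≡ inj₂ y
no-three-collinear = toWitness {a? = Fin.all? λ x → Fin.all? λ y → all-vertices? λ w →
  T? (incident x y) →-dec
  (orientℤ (location (inj₁ x)) (location (inj₂ y)) (location w) ℤ.≟ 0ℤ →-dec
   ((w ≟ᵥ inj₁ x) ⊎-dec (w ≟ᵥ inj₂ y)))} tt

edges-split : ∀ x y x′ y′ → T (incident x y) → T (incident x′ y′) → ¬ (x ≡ x′ × y ≡ y′) →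
    SplitBy (location (inj₁ x)) (location (inj₂ y)) (location (inj₁ x′)) (location (inj₂ y′)) ⊎
    SplitBy (location (inj₁ x′)) (location (inj₂ y′)) (location (inj₁ x)) (location (inj₂ y))
edges-split = toWitness {a? = Fin.all? λ x → Fin.all? λ y → Fin.all? λ x′ → Fin.all? λ y′ →
  T? (incident x y) →-dec (T? (incident x′ y′) →-dec (¬? (x ≟ x′ ×-dec y ≟ y′) →-dec
  (split? (location (inj₁ x)) (location (inj₂ y)) (location (inj₁ x′)) (location (inj₂ y′)) ⊎-dec
   split? (location (inj₁ x′)) (location (inj₂ y′)) (location (inj₁ x)) (location (inj₂ y)))))} tt

example : Graph (Fin 16)
example = mapGraph incident

forest-edges : All (λ e → Adj example (proj₁ e) (proj₂ e)) forest
forest-edges = toWitness {a? = All.all? (λ (u , v) → T? (adj example u v)) forest} tt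

-- Decided by evaluating the enumeration. For the empty clique the truncated `0 ∸ 1` is 0, matching
-- the absence of edges inside it.
forest-acyclic : All (λ C → length (inside C forest) ℕ.≤ length C ∸ 1) (cliques example (allFin 16))
forest-acyclic = toWitness
  {a? = All.all? (λ C → length (inside C forest) ℕ.≤? length C ∸ 1) (cliques example (allFin 16))} tt

proposition3p10 : ExcludedMiddle 0ℓ → Σ ℕ λ n → Σ (Graph (Fin n)) λ G → ZeroMapGraph G × ¬ ContactStringGraph G
proposition3p10 em = 16 , example ,
  mapGraph-zeroMap incident
    (StraightLine.drawing incident location columns-distinct no-three-collinear edges-split) ,
  -- `forest` has 33 edges, while `forest-size` allows only 16 * 2 = 32.
  λ strings → contradiction (forest-size em example strings forest forest-edges forest-acyclic) (ℕ.<⇒≱ ℕ.≤-refl)
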